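{- For every $n\geq 4$, the poset $\mathcal{E}_n$ is not a lattice.
   Context: All graphs are finite and simple. The chromatic symmetric function of a graph $G$ with vertices $v_1,\dots,v_n$ is $X_G=\sum_{\kappa}x_{\kappa(v_1)}\cdots x_{\kappa(v_n)}$, summed over all proper colorings $\kappa:V(G)\to\{1,2,3,\dots\}$; it is a homogeneous symmetric function of degree $n$ over $\mathbb{Q}$. Let $e_\lambda=e_{\lambda_1}e_{\lambda_2}\cdots$ be the elementary symmetric functions; $[e_\lambda]F$ denotes the coefficient of $e_\lambda$ in $F$ expanded in this basis, and $F$ is $e$-positive if $[e_\lambda]F\ge 0$ for all $\lambda$. For connected graphs $G,H$ on $n$ vertices (for which $[e_{(n)}]X_G$ and $[e_{(n)}]X_H$ are positive), set $$X_e(G,H)=X_G-\frac{[e_{(n)}]X_G}{[e_{(n)}]X_H}X_H.$$ $\mathcal{E}_n$ is the poset whose elements are the equivalence classes of connected graphs on $n$ vertices under $G\sim H\iff X_G=X_H$, ordered by $G\geq_e H$ if and only if $X_e(G,H)$ is $e$-positive. -}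

module Defs where

open import Data.Bool.Base using (if_then_else_)
open import Data.Fin.Base using (Fin)
import Data.Fin.Properties as Fin
open import Data.Integer.Base using (+_)
open import Data.List.Base
  using (List; []; _∷_; allFin; cartesianProductWith; concatMap; filter; foldr; length; map; upTo)
open import Data.List.Properties using (≡-dec)
open import Data.List.Relation.Unary.All using (All; all?)
open import Data.List.Relation.Unary.Linked using (Linked; linked?)
open import Data.Nat.Base using (ℕ; zero; suc; _∸_)
import Data.Nat.Base as ℕ
open import Data.Nat.ListAction using (sum)
import Data.Nat.Properties as ℕ
open import Data.Product.Base using (Σ-syntax; ∃₂; _×_; _,_)
open import Data.Rational.Base
  using (ℚ; 0ℚ; 1ℚ; NonZero; Positive; _+_; _*_; _-_; _÷_; _/_; _≤_)
open import Data.Rational.Properties using (pos⇒nonZero)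
open import Data.Vec.Base using (Vec; lookup; count)
import Data.Vec.Base as Vec
open import Function.Base using (flip)
open import Level using (0ℓ)
import Level
open import Relation.Binary.Bundles.Raw using (RawRelation)
open import Relation.Binary.Construct.Closure.ReflexiveTransitive using (Star)
open import Relation.Binary.Core using (Rel)
open import Relation.Binary.Definitions using (Decidable; Irreflexive; Symmetric)
open import Relation.Binary.Lattice.Definitions using (Supremum; Infimum)
open import Relation.Binary.PropositionalEquality
  using (_≡_; _≢_; _≗_; sym; trans; cong₂; cong)
open import Relation.Nullary.Decidable using (Dec; does; ¬?; _×-dec_; _→-dec_)

------------------------------------------------------------------------
-- Graphs

record Graph (n : ℕ) : Set (Level.suc 0ℓ) where
  infix 4 _~_ _~?_
  field
    _~_    : Rel (Fin n) 0ℓ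
    _~?_   : Decidable _~_
    ~-sym  : Symmetric _~_
    ~-irr  : Irreflexive _≡_ _~_

record ConnectedGraph (n : ℕ) : Set (Level.suc 0ℓ) where
  field
    graph     : Graph n
  open Graph graph public
  field
    connected : ∀ u v → Star _~_ u v

------------------------------------------------------------------------
-- Formal power series in x₁, x₂, … over ℚ

-- The list α₁ ∷ … ∷ αₖ ∷ [] is the monomial x₁^α₁ ⋯ xₖ^αₖ; appending zeros
-- to a list does not change the monomial.
Monomial : Set
Monomial = List ℕ

-- A series is given by its coefficients.
Series : Set
Series = Monomial → ℚ

∑ : List ℚ → ℚ
∑ = foldr _+_ 0ℚ

-- All pairs (β , γ) with β · γ equal to the given monomial.
factorisations : Monomial → List (Monomial × Monomial)
factorisations []      = ([] , []) ∷ []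
factorisations (a ∷ α) =
  cartesianProductWith (λ b (β , γ) → (b ∷ β) , ((a ∸ b) ∷ γ))
    (upTo (suc a)) (factorisations α)

infixl 7 _⊛_ _•_
infixl 6 _⊖_

_⊛_ : Series → Series → Series
(F ⊛ G) α = ∑ (map (λ (β , γ) → F β * G γ) (factorisations α))

_•_ : ℚ → Series → Series
(q • F) α = q * F α

_⊖_ : Series → Series → Series
(F ⊖ G) α = F α - G α

-- All words of length n over the given letters.
words : {A : Set} → List A → (n : ℕ) → List (Vec A n)
words as zero    = Vec.[] ∷ []
words as (suc n) = cartesianProductWith Vec._∷_ as (words as n)

------------------------------------------------------------------------
-- The chromatic symmetric function

Proper : ∀ {n k} → Graph n → Vec (Fin k) n → Set
Proper G κ = ∀ u v → u ~ v → lookup κ u ≢ lookup κ v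
  where open Graph G

proper? : ∀ {n k} (G : Graph n) (κ : Vec (Fin k) n) → Dec (Proper G κ)
proper? G κ = Fin.all? λ u → Fin.all? λ v →
  (u ~? v) →-dec ¬? (lookup κ u Fin.≟ lookup κ v)
  where open Graph G

-- The monomial x_κ(v₁) ⋯ x_κ(vₙ).
content : ∀ {n k} → Vec (Fin k) n → Monomial
content {k = k} κ = map (λ i → count (Fin._≟ i) κ) (allFin k)

-- A colouring contributing to the coefficient of x₁^α₁ ⋯ xₖ^αₖ only uses
-- the colours 1, …, k.
X : ∀ {n} → Graph n → Series
X {n} G α = + length (filter contributes? (words (allFin (length α)) n)) / 1
  where
  contributes? : (κ : Vec (Fin (length α)) n) → Dec (Proper G κ × content κ ≡ α)
  contributes? κ = proper? G κ ×-dec ≡-dec ℕ._≟_ (content κ) α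

------------------------------------------------------------------------
-- Partitions and elementary symmetric functions

IsPartition : ℕ → List ℕ → Set
IsPartition n p = Linked ℕ._≥_ p × All (0 ℕ.<_) p × sum p ≡ n

isPartition? : ∀ n p → Dec (IsPartition n p)
isPartition? n p =
  linked? ℕ._≥?_ p ×-dec all? (0 ℕ.<?_) p ×-dec (sum p ℕ.≟ n)

-- Every partition of n has at most n parts, each between 1 and n.
partitions : ℕ → List (List ℕ)
partitions n = filter (isPartition? n)
  (concatMap (λ l → map Vec.toList (words (map suc (upTo n)) l)) (upTo (suc n)))

-- The sum of all squarefree monomials of degree j; in particular e 0 is 1.
e : ℕ → Series
e j α = if does (all? (ℕ._≤? 1) α ×-dec (sum α ℕ.≟ j)) then 1ℚ else 0ℚ

e⟦_⟧ : List ℕ → Series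
e⟦ p ⟧ = foldr (λ j F → e j ⊛ F) (e 0) p

-- An expansion F = ∑ c_λ e_λ over the partitions λ of n.  As the e_λ form a
-- basis, every symmetric F of degree n has exactly one (up to the values of
-- coeff at lists that are not partitions of n), and coeff λ is [e_λ]F.
record EExpansion (n : ℕ) (F : Series) : Set where
  field
    coeff   : List ℕ → ℚ
    expands : F ≗ λ α → ∑ (map (λ p → coeff p * e⟦ p ⟧ α) (partitions n))

open EExpansion

EPositive : ℕ → Series → Set
EPositive n F = Σ[ E ∈ EExpansion n F ] (∀ p → IsPartition n p → 0ℚ ≤ coeff E p)

------------------------------------------------------------------------
-- The poset ℰₙ

-- [e_(n)]F
top : ∀ {n F} → EExpansion n F → ℚ
top {n} E = coeff E (n ∷ [])

-- X_e(G,H) for F = X_G and F′ = X_H.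
Xₑ : ∀ {n} {F F′ : Series} (E : EExpansion n F) (E′ : EExpansion n F′) →
     .{{NonZero (top E′)}} → Series
Xₑ {F = F} {F′} E E′ = F ⊖ (top E ÷ top E′) • F′

infix 4 _≥ₑ_ _≤ₑ_ _∼_

-- The series X_e(G,H) is only formed when [e_(n)]X_G and [e_(n)]X_H are
-- positive, which is automatic for connected graphs.
record _≥ₑ_ {n : ℕ} (G H : ConnectedGraph n) : Set where
  open ConnectedGraph
  field
    expG : EExpansion n (X (graph G))
    expH : EExpansion n (X (graph H))
    posG : Positive (top expG)
    posH : Positive (top expH)
    ePos : EPositive n (Xₑ expG expH {{pos⇒nonZero (top expH) {{posH}}}})

_≤ₑ_ : ∀ {n} → Rel (ConnectedGraph n) 0ℓ
_≤ₑ_ = flip _≥ₑ_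

_∼_ : ∀ {n} → Rel (ConnectedGraph n) 0ℓ
G ∼ H = X (graph G) ≗ X (graph H)
  where open ConnectedGraph

-- The order is well defined on ∼-classes.
≥ₑ-resp-∼ : ∀ {n} {G G′ H H′ : ConnectedGraph n} →
            G ∼ G′ → H ∼ H′ → G ≥ₑ H → G′ ≥ₑ H′
≥ₑ-resp-∼ G∼G′ H∼H′ G≥H = record
  { expG = record { coeff = coeff expG ; expands = λ α → trans (sym (G∼G′ α)) (expands expG α) }
  ; expH = record { coeff = coeff expH ; expands = λ α → trans (sym (H∼H′ α)) (expands expH α) }
  ; posG = posG
  ; posH = posH
  ; ePos = let (E , E≥0) = ePos in
      record { coeff   = coeff E
             ; expands = λ α → trans
                 (cong₂ _-_ (sym (G∼G′ α)) (cong (r *_) (sym (H∼H′ α))))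
                 (expands E α) }
      , E≥0
  }
  where
  open _≥ₑ_ G≥H
  r : ℚ
  r = (top expG ÷ top expH) {{pos⇒nonZero (top expH) {{posH}}}}

-- Elements are representatives of the ∼-classes, with _≈_ identifying
-- representatives of the same class.
ℰ : ℕ → RawRelation (Level.suc 0ℓ) 0ℓ 0ℓ
ℰ n = record { Carrier = ConnectedGraph n ; _≈_ = _∼_ ; _∼_ = _≤ₑ_ }

-- Any two elements have a join and a meet.  Joins and meets in a poset are
-- unique up to _≈_, so choosing them on representatives is no restriction.
-- The partial order laws are deliberately not part of this definition, so
-- that its negation asserts that some join or meet fails to exist.
IsLattice : ∀ {c ℓ₁ ℓ₂} → RawRelation c ℓ₁ ℓ₂ → Set _
IsLattice P = ∃₂ λ _∨_ _∧_ → Supremum _≤P_ _∨_ × Infimum _≤P_ _∧_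
  where open RawRelation P renaming (_∼_ to _≤P_)

{-# OPTIONS --safe #-}

-- The complete graph and the star have no common lower bound M.  On monomials in
-- two variables X_K vanishes, so the e-positivity of X_K - r X_M, all of whose
-- coefficients are therefore nonnegative, forces X_M to vanish there as well.  Hence
-- X_S - s X_M agrees with X_S on such monomials: its coefficient is positive at
-- x^(n-1) y (centre coloured y) and zero at x^(n-2) y^2 (the colour of the centre is
-- used once).  But an e-positive series with a positive coefficient at x^(a+1) y^b,
-- where b ≤ a, also has one at x^a y^(b+1), because every e_λ has this property.
module Submission where

open import Defs
open import Data.Bool.Base using (if_then_else_)
open import Data.Fin.Base using (Fin; zero; suc)
import Data.Fin.Properties as Fin
open import Data.Integer.Base using (+_)
open import Data.List.Base using (List; []; _∷_; allFin; concatMap; filter; length; map; upTo)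
open import Data.List.Membership.Propositional using (_∈_; lose)
open import Data.List.Membership.Propositional.Properties
  using (∈-allFin; ∈-cartesianProductWith⁺; ∈-cartesianProductWith⁻; ∈-filter⁻; ∈-upTo⁺; ∈-upTo⁻)
open import Data.List.Properties using (filter-none; filter-some; ≡-dec)
open import Data.List.Relation.Unary.All as All using (All; []; _∷_; all?)
open import Data.List.Relation.Unary.Any using (here; there)
open import Data.Nat.Base using (ℕ; _≥_; zero; suc; z≤n; s≤s)
import Data.Nat.Base as ℕ
open import Data.Nat.ListAction using (sum)
import Data.Nat.Properties as ℕ
open import Data.Product.Base using (∃-syntax; ∃₂; _×_; _,_; proj₁; proj₂)
open import Data.Rational.Base
  using (ℚ; 0ℚ; 1ℚ; _+_; _*_; _-_; _÷_; -_; _/_; _≤_; _<_; 1/_; NonZero; Positive; nonNegative; positive)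
open import Data.Rational.Properties
open import Data.Sum.Base using (_⊎_; inj₁; inj₂; swap; [_,_]′)
open import Data.Vec.Base as Vec using (Vec; []; _∷_; count; lookup; replicate)
open import Data.Vec.Properties using (lookup-replicate)
open import Function.Base using (_∘_; case_of_)
open import Relation.Binary.Construct.Closure.ReflexiveTransitive using (Star; ε; _◅_)
open import Relation.Binary.PropositionalEquality
open import Relation.Nullary.Decidable using (Dec; does; yes; no; ¬?; _×-dec_; _⊎-dec_)
open import Relation.Nullary.Negation using (¬_; contradiction)

-- Signs of products and sums of rationals

*-nonNeg : ∀ {p q} → 0ℚ ≤ p → 0ℚ ≤ q → 0ℚ ≤ p * q
*-nonNeg {p} {q} 0≤p 0≤q = nonNegative⁻¹ (p * q)
  {{nonNeg*nonNeg⇒nonNeg p {{nonNegative 0≤p}} q {{nonNegative 0≤q}}}}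

*-pos : ∀ {p q} → 0ℚ < p → 0ℚ < q → 0ℚ < p * q
*-pos {p} {q} 0<p 0<q = positive⁻¹ (p * q)
  {{pos*pos⇒pos p {{positive 0<p}} q {{positive 0<q}}}}

*-pos⁻ : ∀ {p q} → 0ℚ ≤ p → 0ℚ ≤ q → 0ℚ < p * q → 0ℚ < p × 0ℚ < q
*-pos⁻ {p} {q} 0≤p 0≤q 0<pq =
    *-cancelʳ-<-nonNeg q {{nonNegative 0≤q}} (subst (_< p * q) (sym (*-zeroˡ q)) 0<pq)
  , *-cancelˡ-<-nonNeg p {{nonNegative 0≤p}} (subst (_< p * q) (sym (*-zeroʳ p)) 0<pq)

module _ {A : Set} (f : A → ℚ) where

  ∑-nonNeg : ∀ xs → (∀ {x} → x ∈ xs → 0ℚ ≤ f x) → 0ℚ ≤ ∑ (map f xs)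
  ∑-nonNeg []       _   = ≤-refl
  ∑-nonNeg (x ∷ xs) f≥0 = +-mono-≤ (f≥0 (here refl)) (∑-nonNeg xs (f≥0 ∘ there))

  ∑-pos⁺ : ∀ {xs x} → (∀ {x} → x ∈ xs → 0ℚ ≤ f x) → x ∈ xs → 0ℚ < f x → 0ℚ < ∑ (map f xs)
  ∑-pos⁺ {_ ∷ xs} f≥0 (here refl) fx>0 = +-mono-<-≤ fx>0 (∑-nonNeg xs (f≥0 ∘ there))
  ∑-pos⁺          f≥0 (there x∈)  fx>0 = +-mono-≤-< (f≥0 (here refl)) (∑-pos⁺ (f≥0 ∘ there) x∈ fx>0)

  ∑-pos⁻ : ∀ xs → 0ℚ < ∑ (map f xs) → ∃[ x ] x ∈ xs × 0ℚ < f x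
  ∑-pos⁻ []       0<0 = contradiction 0<0 (<-irrefl refl)
  ∑-pos⁻ (x ∷ xs) 0<s with 0ℚ <? f x
  ... | yes fx>0 = x , here refl , fx>0
  ... | no  fx≯0 =
    let y , y∈ , fy>0 = ∑-pos⁻ xs (<-≤-trans 0<s
          (subst (f x + ∑ (map f xs) ≤_) (+-identityˡ _) (+-monoˡ-≤ _ (≮⇒≥ fx≯0))))
    in y , there y∈ , fy>0

-- Products of series with nonnegative coefficients

NonNegativeSeries : Series → Set
NonNegativeSeries F = ∀ α → 0ℚ ≤ F α

-- The coefficient of x^a y^b.
_⟨_,_⟩ : Series → ℕ → ℕ → ℚ
F ⟨ a , b ⟩ = F (a ∷ b ∷ [])

∷-∈-factorisations⁺ : ∀ α {β γ} b c → (β , γ) ∈ factorisations α →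
                      (b ∷ β , c ∷ γ) ∈ factorisations (b ℕ.+ c ∷ α)
∷-∈-factorisations⁺ α {β} {γ} b c βγ∈ =
  -- The complementary exponent is listed as `b + c ∸ b`, which equals `c` only propositionally.
  subst (λ x → (b ∷ β , x ∷ γ) ∈ factorisations (b ℕ.+ c ∷ α)) (ℕ.m+n∸m≡n b c)
    (∈-cartesianProductWith⁺ (λ x (β , γ) → (x ∷ β) , ((b ℕ.+ c ℕ.∸ x) ∷ γ))
      (∈-upTo⁺ (s≤s (ℕ.m≤m+n b c))) βγ∈)

∈-factorisations⁻ : ∀ a α {δ} → δ ∈ factorisations (a ∷ α) →
                    ∃₂ λ b c → ∃₂ λ β γ → δ ≡ (b ∷ β , c ∷ γ) × b ℕ.+ c ≡ a × (β , γ) ∈ factorisations α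
∈-factorisations⁻ a α δ∈ =
  let b , _ , b∈ , βγ∈ , δ≡ = ∈-cartesianProductWith⁻ (λ x (β , γ) → (x ∷ β) , ((a ℕ.∸ x) ∷ γ))
        (upTo (suc a)) (factorisations α) δ∈
  in b , a ℕ.∸ b , _ , _ , δ≡ , ℕ.m+[n∸m]≡n (ℕ.≤-pred (∈-upTo⁻ b∈)) , βγ∈

module _ {F G : Series} (F≥0 : NonNegativeSeries F) (G≥0 : NonNegativeSeries G) where

  private
    term-nonNeg : ∀ α {δ} → δ ∈ factorisations α → 0ℚ ≤ F (proj₁ δ) * G (proj₂ δ)
    term-nonNeg _ {β , γ} _ = *-nonNeg (F≥0 β) (G≥0 γ)

  ⊛-nonNeg : NonNegativeSeries (F ⊛ G)
  ⊛-nonNeg α = ∑-nonNeg _ (factorisations α) (term-nonNeg α)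

  ⊛-pos⁺ : ∀ α {β γ} → (β , γ) ∈ factorisations α → 0ℚ < F β → 0ℚ < G γ → 0ℚ < (F ⊛ G) α
  ⊛-pos⁺ α βγ∈ 0<F 0<G = ∑-pos⁺ _ {factorisations α} (term-nonNeg α) βγ∈ (*-pos 0<F 0<G)

  -- A positive sum has a positive term, and nonnegative factors with a positive product are both
  -- positive.
  ⊛-pos⁻ : ∀ α → 0ℚ < (F ⊛ G) α →
           ∃₂ λ β γ → (β , γ) ∈ factorisations α × 0ℚ < F β × 0ℚ < G γ
  ⊛-pos⁻ α 0<FG =
    let (β , γ) , βγ∈ , 0<term = ∑-pos⁻ _ (factorisations α) 0<FG
    in β , γ , βγ∈ , *-pos⁻ (F≥0 β) (G≥0 γ) 0<term

  ⊛-pos₂⁺ : ∀ a b {a′ b′} → 0ℚ < F ⟨ a , b ⟩ → 0ℚ < G ⟨ a′ , b′ ⟩ →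
            0ℚ < (F ⊛ G) ⟨ a ℕ.+ a′ , b ℕ.+ b′ ⟩
  ⊛-pos₂⁺ a b {a′} {b′} =
    ⊛-pos⁺ (a ℕ.+ a′ ∷ b ℕ.+ b′ ∷ [])
      (∷-∈-factorisations⁺ (b ℕ.+ b′ ∷ []) a a′ (∷-∈-factorisations⁺ [] b b′ (here refl)))

  ⊛-pos₂⁻ : ∀ {c d} → 0ℚ < (F ⊛ G) ⟨ c , d ⟩ →
            ∃₂ λ a b → ∃₂ λ a′ b′ → a ℕ.+ a′ ≡ c × b ℕ.+ b′ ≡ d ×
              0ℚ < F ⟨ a , b ⟩ × 0ℚ < G ⟨ a′ , b′ ⟩
  ⊛-pos₂⁻ {c} {d} 0<FG with ⊛-pos⁻ (c ∷ d ∷ []) 0<FG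
  ... | β , γ , βγ∈ , 0<F , 0<G with ∈-factorisations⁻ c (d ∷ []) βγ∈
  ... | a , a′ , β′ , γ′ , refl , a+a′≡c , β′γ′∈ with ∈-factorisations⁻ d [] β′γ′∈
  ... | b , b′ , _ , _ , refl , b+b′≡d , here refl = a , b , a′ , b′ , a+a′≡c , b+b′≡d , 0<F , 0<G

-- Elementary symmetric functions

module _ {P : Set} where

  indicator-nonNeg : (P? : Dec P) → 0ℚ ≤ (if does P? then 1ℚ else 0ℚ)
  indicator-nonNeg (yes _) = nonNegative⁻¹ 1ℚ
  indicator-nonNeg (no  _) = ≤-refl

  indicator-pos⁺ : (P? : Dec P) → P → 0ℚ < (if does P? then 1ℚ else 0ℚ)
  indicator-pos⁺ (yes _) _ = positive⁻¹ 1ℚ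
  indicator-pos⁺ (no ¬p) p = contradiction p ¬p

  indicator-pos⁻ : (P? : Dec P) → 0ℚ < (if does P? then 1ℚ else 0ℚ) → P
  indicator-pos⁻ (yes p) _   = p
  indicator-pos⁻ (no  _) 0<0 = contradiction 0<0 (<-irrefl refl)

-- This is the test inside the definition of `e`, named so that the indicator lemmas apply to
-- `e j α` by unfolding.
squarefree? : ∀ j α → Dec (All (ℕ._≤ 1) α × sum α ≡ j)
squarefree? j α = all? (ℕ._≤? 1) α ×-dec (sum α ℕ.≟ j)

e-nonNeg : ∀ j → NonNegativeSeries (e j)
e-nonNeg j α = indicator-nonNeg (squarefree? j α)

e-pos⁺ : ∀ j α → All (ℕ._≤ 1) α → sum α ≡ j → 0ℚ < e j α
e-pos⁺ j α α≤1 ∑α≡j = indicator-pos⁺ (squarefree? j α) (α≤1 , ∑α≡j)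

e-pos⁻ : ∀ j α → 0ℚ < e j α → All (ℕ._≤ 1) α × sum α ≡ j
e-pos⁻ j α = indicator-pos⁻ (squarefree? j α)

e⟦⟧-nonNeg : ∀ p → NonNegativeSeries e⟦ p ⟧
e⟦⟧-nonNeg []      = e-nonNeg 0
e⟦⟧-nonNeg (j ∷ p) = ⊛-nonNeg (e-nonNeg j) (e⟦⟧-nonNeg p)

-- The induction hypothesis shifts the monomial taken from e_p, except when e_j
-- contributes x and e_p contributes x^a y^a; then e_j contributes y instead.
e⟦⟧-shift : ∀ p {a b} → b ℕ.≤ a →
            0ℚ < e⟦ p ⟧ ⟨ suc a , b ⟩ → 0ℚ < e⟦ p ⟧ ⟨ a , suc b ⟩
e⟦⟧-shift [] {a} {b} _ 0<e with () ← proj₂ (e-pos⁻ 0 (suc a ∷ b ∷ []) 0<e)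
e⟦⟧-shift (j ∷ p) {a} {b} b≤a 0<e =
  let x , y , x′ , y′ , x+x′≡1+a , y+y′≡b , 0<eⱼ , 0<eₚ = ⊛-pos₂⁻ (e-nonNeg j) (e⟦⟧-nonNeg p) 0<e
      xy≤1 , x+y≡j = e-pos⁻ j (x ∷ y ∷ []) 0<eⱼ
  in go (All.head xy≤1) (All.head (All.tail xy≤1)) x+x′≡1+a y+y′≡b b≤a x+y≡j 0<eⱼ 0<eₚ
  where
  mul : ∀ x y {x′ y′} → 0ℚ < e j ⟨ x , y ⟩ → 0ℚ < e⟦ p ⟧ ⟨ x′ , y′ ⟩ →
        0ℚ < e⟦ j ∷ p ⟧ ⟨ x ℕ.+ x′ , y ℕ.+ y′ ⟩
  mul = ⊛-pos₂⁺ (e-nonNeg j) (e⟦⟧-nonNeg p)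
  go : ∀ {x y x′ y′ a b} → x ℕ.≤ 1 → y ℕ.≤ 1 → x ℕ.+ x′ ≡ suc a → y ℕ.+ y′ ≡ b → b ℕ.≤ a →
       x ℕ.+ (y ℕ.+ 0) ≡ j → 0ℚ < e j ⟨ x , y ⟩ → 0ℚ < e⟦ p ⟧ ⟨ x′ , y′ ⟩ →
       0ℚ < e⟦ j ∷ p ⟧ ⟨ a , suc b ⟩
  go z≤n       z≤n       refl refl b≤a       _   0<eⱼ 0<eₚ = mul 0 0 0<eⱼ (e⟦⟧-shift p b≤a 0<eₚ)
  go z≤n       (s≤s z≤n) refl refl b<a       _   0<eⱼ 0<eₚ = mul 0 1 0<eⱼ (e⟦⟧-shift p (ℕ.<⇒≤ b<a) 0<eₚ)
  go (s≤s z≤n) (s≤s z≤n) refl refl (s≤s b≤a) _   0<eⱼ 0<eₚ = mul 1 1 0<eⱼ (e⟦⟧-shift p b≤a 0<eₚ)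
  go (s≤s z≤n) z≤n       refl refl b≤a       1≡j 0<eⱼ 0<eₚ =
    [ (λ { (s≤s b≤a) → mul 1 0 0<eⱼ (e⟦⟧-shift p b≤a 0<eₚ) })
    , (λ { refl → mul 0 1 (e-pos⁺ j (0 ∷ 1 ∷ []) (z≤n ∷ s≤s z≤n ∷ []) 1≡j) 0<eₚ })
    ]′ (ℕ.m≤n⇒m<n∨m≡n b≤a)

-- Coefficients of e-positive series

module _ {n : ℕ} {F : Series} (Fpos : EPositive n F) where

  private
    open EExpansion (proj₁ Fpos)

    candidates : List (List ℕ)
    candidates = concatMap (λ l → map Vec.toList (words (map suc (upTo n)) l)) (upTo (suc n))

    coeff-nonNeg : ∀ {p} → p ∈ partitions n → 0ℚ ≤ coeff p
    coeff-nonNeg p∈ = proj₂ Fpos _ (proj₂ (∈-filter⁻ (isPartition? n) {xs = candidates} p∈))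

    term-nonNeg : ∀ α {p} → p ∈ partitions n → 0ℚ ≤ coeff p * e⟦ p ⟧ α
    term-nonNeg α {p} p∈ = *-nonNeg (coeff-nonNeg p∈) (e⟦⟧-nonNeg p α)

  EPositive⇒nonNeg : NonNegativeSeries F
  EPositive⇒nonNeg α = subst (0ℚ ≤_) (sym (expands α)) (∑-nonNeg _ (partitions n) (term-nonNeg α))

  -- A positive coefficient of F comes from some term c_λ e_λ with both factors positive. The shift
  -- keeps this term positive, and no other term can cancel it because all are nonnegative.
  EPositive-shift : ∀ a b → b ℕ.≤ a → 0ℚ < F ⟨ suc a , b ⟩ → 0ℚ < F ⟨ a , suc b ⟩
  EPositive-shift a b b≤a 0<F =
    let p , p∈ , 0<term = ∑-pos⁻ _ (partitions n) (subst (0ℚ <_) (expands _) 0<F)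
        0<c , 0<e = *-pos⁻ (coeff-nonNeg p∈) (e⟦⟧-nonNeg p _) 0<term
    in subst (0ℚ <_) (sym (expands _))
         (∑-pos⁺ _ (term-nonNeg _) p∈ (*-pos 0<c (e⟦⟧-shift p b≤a 0<e)))

-- The ratio of the two top coefficients is packaged as some positive `r`, the form in which the
-- order is used below.
≥ₑ⇒EPositive : ∀ {n} {G H : ConnectedGraph n} → G ≥ₑ H → let open ConnectedGraph in
               ∃[ r ] 0ℚ < r × EPositive n (X (graph G) ⊖ r • X (graph H))
≥ₑ⇒EPositive G≥H = r , 0<r , ePos
  where
  open _≥ₑ_ G≥H
  instance
    topG>0 : Positive (top expG)
    topG>0 = posG
    topH>0 : Positive (top expH)
    topH>0 = posH
    topH≢0 : NonZero (top expH)
    topH≢0 = pos⇒nonZero (top expH)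
    1/topH>0 : Positive (1/ top expH)
    1/topH>0 = 1/pos⇒pos (top expH)
  r : ℚ
  r = top expG ÷ top expH
  0<r : 0ℚ < r
  0<r = *-pos (positive⁻¹ (top expG)) (positive⁻¹ (1/ top expH))

-- Coefficients of the chromatic symmetric function

module _ {n : ℕ} (G : Graph n) (α : Monomial) where

  private
    -- Mirrors the test local to the definition of `X`, so that `X G α` unfolds to `+ number / 1`.
    Contributes : Vec (Fin (length α)) n → Set
    Contributes κ = Proper G κ × content κ ≡ α

    contributes? : ∀ κ → Dec (Contributes κ)
    contributes? κ = proper? G κ ×-dec ≡-dec ℕ._≟_ (content κ) α

    colourings : List (Vec (Fin (length α)) n)
    colourings = words (allFin (length α)) n

    number : ℕ
    number = length (filter contributes? colourings)

  X-nonNeg : 0ℚ ≤ X G α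
  X-nonNeg = nonNegative⁻¹ (+ number / 1) {{normalize-nonNeg number 1}}

  X-zero : (∀ (κ : Vec (Fin (length α)) n) → Proper G κ → content κ ≢ α) → X G α ≡ 0ℚ
  X-zero none = cong (λ κs → + length κs / 1) (filter-none contributes?
    (All.universal (λ κ (proper , κ≡α) → none κ proper κ≡α) colourings))

  X-pos : (κ : Vec (Fin (length α)) n) → Proper G κ → content κ ≡ α → 0ℚ < X G α
  X-pos κ proper κ≡α = positive⁻¹ (+ number / 1) {{normalize-pos number 1}}
    where
    ∈-words : ∀ {k n} (κ : Vec (Fin k) n) → κ ∈ words (allFin k) n
    ∈-words []      = here refl
    ∈-words (c ∷ κ) = ∈-cartesianProductWith⁺ Vec._∷_ (∈-allFin c) (∈-words κ)
    instance
      number≢0 : ℕ.NonZero number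
      number≢0 = ℕ.>-nonZero (filter-some contributes? (lose (∈-words κ) (proper , κ≡α)))

-- The complete graph and the star, and their colourings with two colours

complete : ∀ n → ConnectedGraph n
complete n = record
  { graph = record
    { _~_ = _≢_ ; _~?_ = λ u v → ¬? (u Fin.≟ v) ; ~-sym = ≢-sym ; ~-irr = λ u≡v u≢v → u≢v u≡v }
  ; connected = connected
  }
  where
  connected : ∀ (u v : Fin n) → Star _≢_ u v
  connected u v with u Fin.≟ v
  ... | yes refl = ε
  ... | no u≢v   = u≢v ◅ ε

-- The index counts the leaves; the centre is the vertex `zero`.
star : ∀ n → ConnectedGraph (suc n)
star n = record
  { graph = record
    { _~_   = _~_
    ; _~?_  = λ u v → ¬? (u Fin.≟ v) ×-dec ((u Fin.≟ zero) ⊎-dec (v Fin.≟ zero))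
    ; ~-sym = ~-sym
    ; ~-irr = λ u≡v (u≢v , _) → u≢v u≡v
    }
  ; connected = connected
  }
  where
  _~_ : Fin (suc n) → Fin (suc n) → Set
  u ~ v = u ≢ v × (u ≡ zero ⊎ v ≡ zero)
  ~-sym : ∀ {u v} → u ~ v → v ~ u
  ~-sym (u≢v , centre) = ≢-sym u≢v , swap centre
  fromCentre : ∀ v → Star _~_ zero v
  fromCentre zero    = ε
  fromCentre (suc v) = ((λ ()) , inj₁ refl) ◅ ε
  connected : ∀ u v → Star _~_ u v
  connected zero    v = fromCentre v
  connected (suc u) v = ((λ ()) , inj₂ refl) ◅ fromCentre v

private
  module C n = ConnectedGraph (complete n)
  module S n = ConnectedGraph (star n)

-- Two of the vertices must share one of the two colours, yet any two distinct vertices are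
-- adjacent.
X-complete : ∀ {n} → 2 ℕ.< n → ∀ a b → X (C.graph n) ⟨ a , b ⟩ ≡ 0ℚ
X-complete {n} 2<n a b = X-zero (C.graph n) (a ∷ b ∷ []) λ κ proper _ →
  let u , v , u<v , κu≡κv = Fin.pigeonhole 2<n (lookup κ)
  in proper u v (Fin.<⇒≢ u<v) κu≡κv

count-none : ∀ {k n} (i : Fin k) (κ : Vec (Fin k) n) → (∀ v → lookup κ v ≢ i) →
             count (Fin._≟ i) κ ≡ 0
count-none i []      _    = refl
count-none i (c ∷ κ) κ≢i with c Fin.≟ i
... | yes c≡i = contradiction c≡i (κ≢i zero)
... | no  _   = count-none i κ (κ≢i ∘ suc)

count-replicate : ∀ {k} n (i : Fin k) → count (Fin._≟ i) (replicate n i) ≡ n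
count-replicate zero    i = refl
count-replicate (suc n) i with i Fin.≟ i
... | yes _  = cong suc (count-replicate n i)
... | no i≢i = contradiction refl i≢i

-- Every leaf is adjacent to the centre, so no leaf repeats its colour.
count-centre : ∀ {n k} c (κ : Vec (Fin k) n) → Proper (S.graph n) (c ∷ κ) →
               count (Fin._≟ c) (c ∷ κ) ≡ 1
count-centre c κ proper with c Fin.≟ c
... | no c≢c = contradiction refl c≢c
... | yes _  = cong suc (count-none c κ λ v κv≡c → proper zero (suc v) ((λ ()) , inj₁ refl) (sym κv≡c))

-- The exponent belonging to the colour of the centre would have to be 1.
X-star-zero : ∀ n a b → 1 ℕ.< a → 1 ℕ.< b → X (S.graph n) ⟨ a , b ⟩ ≡ 0ℚ
X-star-zero n a b 1<a 1<b = X-zero (S.graph n) (a ∷ b ∷ []) λ where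
  (zero ∷ κ) proper refl → ℕ.<⇒≢ 1<a (sym (count-centre zero κ proper))
  (suc zero ∷ κ) proper refl → ℕ.<⇒≢ 1<b (sym (count-centre (suc zero) κ proper))

X-star-pos : ∀ n → 0ℚ < X (S.graph n) ⟨ n , 1 ⟩
X-star-pos n = X-pos (S.graph n) (n ∷ 1 ∷ []) (suc zero ∷ replicate n zero) proper
  (cong₂ (λ a b → a ∷ suc b ∷ []) (count-replicate n zero)
    (count-none (suc zero) (replicate n zero) λ v eq → case trans (sym (lookup-replicate v zero)) eq of λ ()))
  where
  proper : Proper (S.graph n) (suc zero ∷ replicate n zero)
  proper zero    zero    (u≢v , _) _ = u≢v refl
  proper zero    (suc v) _ eq with () ← trans eq (lookup-replicate v zero)
  proper (suc u) zero    _ eq with () ← trans (sym eq) (lookup-replicate u zero)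
  proper (suc u) (suc v) (_ , inj₁ ())
  proper (suc u) (suc v) (_ , inj₂ ())

-- Graphs without a common lower bound

⊖•-zero : ∀ (F G : Series) r α → G α ≡ 0ℚ → (F ⊖ r • G) α ≡ F α
⊖•-zero F G r α Gα≡0 = begin
  F α - r * G α ≡⟨ cong (λ q → F α - r * q) Gα≡0 ⟩
  F α - r * 0ℚ  ≡⟨ cong (λ q → F α - q) (*-zeroʳ r) ⟩
  F α - 0ℚ      ≡⟨ +-identityʳ (F α) ⟩
  F α           ∎
  where open ≡-Reasoning

-- If `G α` were positive, the difference would be `- (r * G α)`, which is negative.
⊖•-nonNeg⇒zero : ∀ (F G : Series) r α → 0ℚ < r → 0ℚ ≤ G α → 0ℚ ≤ (F ⊖ r • G) α →
                 F α ≡ 0ℚ → G α ≡ 0ℚ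
⊖•-nonNeg⇒zero F G r α 0<r 0≤G 0≤F-rG Fα≡0 = ≤-antisym (≮⇒≥ G≯0) 0≤G
  where
  G≯0 : ¬ (0ℚ < G α)
  G≯0 0<G = <-irrefl refl (≤-<-trans
    (subst (0ℚ ≤_) (trans (cong (_- r * G α) Fα≡0) (+-identityˡ _)) 0≤F-rG)
    (neg-antimono-< (*-pos 0<r 0<G)))

-- F and F - rG agree on monomials in two variables, so F inherits the shift there.
EPositive-shift-⊖• : ∀ {n} (F G : Series) r → EPositive n (F ⊖ r • G) →
                     (∀ a b → G ⟨ a , b ⟩ ≡ 0ℚ) →
                     ∀ a b → b ℕ.≤ a → 0ℚ < F ⟨ suc a , b ⟩ → 0ℚ < F ⟨ a , suc b ⟩
EPositive-shift-⊖• F G r F-rG G≡0 a b b≤a 0<F =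
  subst (0ℚ <_) (agree a (suc b))
    (EPositive-shift F-rG a b b≤a (subst (0ℚ <_) (sym (agree (suc a) b)) 0<F))
  where
  agree : ∀ a b → (F ⊖ r • G) ⟨ a , b ⟩ ≡ F ⟨ a , b ⟩
  agree a b = ⊖•-zero F G r (a ∷ b ∷ []) (G≡0 a b)

-- Isolates what is asked of the two graphs: X_K vanishes on monomials in two variables, while X_S
-- violates the shift at one of them.
no-lowerBound : ∀ {n} (K S M : ConnectedGraph n) → let open ConnectedGraph in
                (∀ a b → X (graph K) ⟨ a , b ⟩ ≡ 0ℚ) →
                ∀ a b → b ℕ.≤ a → 0ℚ < X (graph S) ⟨ suc a , b ⟩ → X (graph S) ⟨ a , suc b ⟩ ≡ 0ℚ →
                K ≥ₑ M → ¬ (S ≥ₑ M)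
no-lowerBound K S M XK≡0 a b b≤a 0<XS XS≡0 K≥M S≥M =
  let r , 0<r , XK-rXM = ≥ₑ⇒EPositive K≥M
      s , _   , XS-sXM = ≥ₑ⇒EPositive S≥M
      XM≡0 = λ a b → let α = a ∷ b ∷ [] in
        ⊖•-nonNeg⇒zero (X (graph K)) (X (graph M)) r α 0<r
          (X-nonNeg (graph M) α) (EPositive⇒nonNeg XK-rXM α) (XK≡0 a b)
  in <-irrefl (sym XS≡0)
       (EPositive-shift-⊖• (X (graph S)) (X (graph M)) s XS-sXM XM≡0 a b b≤a 0<XS)
  where open ConnectedGraph

corollary3p14 : ∀ (n : ℕ) → n ≥ 4 → ¬ IsLattice (ℰ n)
corollary3p14 (suc (suc n)) (s≤s (s≤s 2≤n)) (_ , _∧_ , _ , infimum) =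
  let K = complete (suc (suc n))
      S = star (suc n)
      -- A meet would be a common lower bound of K and S.
      K∧S≤K , K∧S≤S , _ = infimum K S
  -- Here `n` is the number of vertices minus 2, so the monomials are x^(n+1) y and x^n y^2. Four
  -- vertices give `2 ≤ n`, so both exponents of the latter exceed 1.
  in no-lowerBound K S (K ∧ S) (X-complete (s≤s (ℕ.m≤n⇒m≤1+n 2≤n))) n 1 (ℕ.<⇒≤ 2≤n)
       (X-star-pos (suc n)) (X-star-zero (suc n) n 2 2≤n ℕ.≤-refl) K∧S≤K K∧S≤S
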